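{- Consider SALIQUOT. Then $\mathcal{SG}(0)=0$. Suppose that $n>0$ and let $n=2^{k}m$, where $2\nmid m$ and $k\ge 0$. Then $\mathcal{SG}(n)= v(n)+1=k+1$.
   Context: SALIQUOT is the impartial normal-play game on the nonnegative integers where from $n$ a player subtracts a positive divisor of $n$, i.e. $\mathrm{opt}(n)=\{n-d: d\mid n,\ d>0\}$ (so $0$ has no options); the player unable to move loses. $\mathcal{SG}$ denotes the Sprague-Grundy value, defined by the mex rule. $v(n)$ is the 2-adic valuation of $n$. -}

module Defs where

open import Data.List.Base using (List; map; filter; upTo)
open import Data.List.Extrema.Nat using (max; xs≤max)
open import Data.List.Membership.DecPropositional using () renaming (_∈?_ to mem?)
open import Data.List.Membership.Propositional using (_∈_; _∉_; mapWith∈)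
open import Data.List.Membership.Propositional.Properties using (∈-map⁻; ∈-map⁺; ∈-filter⁻; ∈-filter⁺; ∈-upTo⁺; ∈-upTo⁻; mapWith∈-cong; mapWith∈≗map)
open import Data.List.Relation.Unary.All using (lookup)
open import Data.Nat.Base using (ℕ; zero; suc; _+_; _∸_; _^_; _≤_; _<_; _>_; z≤n; s≤s; NonZero)
open import Data.Nat.Divisibility using (_∣_; _∣?_; ∣⇒≤; 1∣_)
open import Data.Nat.Induction using (<-wellFounded; <-rec)
open import Data.Nat.Properties using (_≟_; ≤-trans; <-irrefl; m<1+n⇒m<n∨m≡n; ∸-monoʳ-<; m∸n+n≡m; m≤n+m; m+n∸n≡m; +-suc; m≤n⇒m<n∨m≡n; ≤-pred; +-identityʳ; +-mono-≤; m^n>0)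
open import Data.Product.Base using (∃; _×_; _,_; proj₁)
open import Data.Sum.Base using (inj₁; inj₂)
open import Function.Bundles using (_⇔_; mk⇔; module Equivalence)
open import Induction.WellFounded using (module FixPoint)
open import Relation.Binary.PropositionalEquality using (_≡_; refl; sym; trans; cong; subst)
open import Relation.Nullary.Decidable.Core using (yes; no)
open import Relation.Nullary.Negation.Core using (contradiction)

IsMex : List ℕ → ℕ → Set
IsMex xs m = m ∉ xs × (∀ j → j < m → j ∈ xs)

mex∃ : (xs : List ℕ) → ∃ (IsMex xs)
mex∃ xs = search (suc (max 0 xs)) 0 (λ _ ())
            (λ b∈ → <-irrefl refl (bounded b∈))
  where
  bounded : ∀ {x} → x ∈ xs → x < suc (max 0 xs) + 0
  bounded x∈ = s≤s (subst (_ ≤_) (sym (+-identityʳ _)) (lookup (xs≤max 0 xs) x∈))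

  search : ∀ gap i → (∀ j → j < i → j ∈ xs) → gap + i ∉ xs → ∃ (IsMex xs)
  search zero      i below i∉ = i , i∉ , below
  search (suc gap) i below top∉ with mem? _≟_ i xs
  ... | no i∉  = i , i∉ , below
  ... | yes i∈ = search gap (suc i) below′ (subst (_∉ xs) (sym (+-suc gap i)) top∉)
    where
    below′ : ∀ j → j < suc i → j ∈ xs
    below′ j j<1+i with m<1+n⇒m<n∨m≡n j<1+i
    ... | inj₁ j<i  = below j j<i
    ... | inj₂ refl = i∈

mex : List ℕ → ℕ
mex xs = proj₁ (mex∃ xs)

module SpragueGrundy
  (opt : ℕ → List ℕ)
  (opt-< : ∀ {n p} → p ∈ opt n → p < n)
  where

  private
    step : ∀ n → (∀ {p} → p < n → ℕ) → ℕ
    step n sg = mex (mapWith∈ (opt n) (λ p∈ → sg (opt-< p∈)))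

    step-ext : ∀ n {f g : ∀ {p} → p < n → ℕ} →
               (∀ {p} (p<n : p < n) → f p<n ≡ g p<n) → step n f ≡ step n g
    step-ext n eq = cong mex (mapWith∈-cong (opt n) _ _ (λ p∈ → eq (opt-< p∈)))

  SG : ℕ → ℕ
  SG = <-rec (λ _ → ℕ) step

  SG-mex : ∀ n → SG n ≡ mex (map SG (opt n))
  SG-mex n = trans (FixPoint.unfold-wfRec <-wellFounded (λ _ → ℕ) step step-ext)
                   (cong mex (mapWith∈≗map SG (opt n)))

-- For n > 0 the bound d ≤ n is automatic; at n = 0 it excludes every d > 0
-- (all of which divide 0), so that opt 0 is empty.
divisors : ℕ → List ℕ
divisors n = filter (_∣? n) (map suc (upTo n))

∈-divisors : ∀ n d → d ∈ divisors n ⇔ (d > 0 × d ∣ n × d ≤ n)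
∈-divisors n d = mk⇔ to from
  where
  to : d ∈ divisors n → d > 0 × d ∣ n × d ≤ n
  to d∈ with ∈-filter⁻ (_∣? n) {xs = map suc (upTo n)} d∈
  ... | d∈′ , d∣n with ∈-map⁻ suc d∈′
  ... | i , i∈ , refl = s≤s z≤n , d∣n , ∈-upTo⁻ i∈

  from : d > 0 × d ∣ n × d ≤ n → d ∈ divisors n
  from (s≤s _ , d∣n , d≤n) = ∈-filter⁺ (_∣? n) (∈-map⁺ suc (∈-upTo⁺ d≤n)) d∣n

opt : ℕ → List ℕ
opt n = map (n ∸_) (divisors n)

opt-< : ∀ {n p} → p ∈ opt n → p < n
opt-< {n} p∈ with ∈-map⁻ (n ∸_) p∈
... | d , d∈ , refl with Equivalence.to (∈-divisors n d) d∈
... | d>0 , _ , d≤n = ∸-monoʳ-< {n} {d} {0} d>0 d≤n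

∈-opt : ∀ n p → p ∈ opt n ⇔ (∃ λ d → d > 0 × d ∣ n × p + d ≡ n)
∈-opt n p = mk⇔ to from
  where
  to : p ∈ opt n → ∃ λ d → d > 0 × d ∣ n × p + d ≡ n
  to p∈ with ∈-map⁻ (n ∸_) p∈
  ... | d , d∈ , refl with Equivalence.to (∈-divisors n d) d∈
  ... | d>0 , d∣n , d≤n = d , d>0 , d∣n , m∸n+n≡m d≤n

  from : (∃ λ d → d > 0 × d ∣ n × p + d ≡ n) → p ∈ opt n
  from (d , d>0 , d∣n , refl) =
    subst (_∈ opt (p + d)) (m+n∸n≡m p d)
      (∈-map⁺ ((p + d) ∸_) (Equivalence.from (∈-divisors (p + d) d)
        (d>0 , d∣n , m≤n+m d p)))

open SpragueGrundy opt opt-< public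

IsValuation₂ : ℕ → ℕ → Set
IsValuation₂ n k = 2 ^ k ∣ n × (∀ j → 2 ^ j ∣ n → j ≤ k)

valuation∃ : ∀ n .{{_ : NonZero n}} → ∃ (IsValuation₂ n)
valuation∃ n = search n (λ j 2^j∣n → ≤-trans (j≤2^j j) (∣⇒≤ 2^j∣n))
  where
  j≤2^j : ∀ j → j ≤ 2 ^ j
  j≤2^j zero    = z≤n
  j≤2^j (suc j) = +-mono-≤ (m^n>0 2 j) (subst (j ≤_) (sym (+-identityʳ (2 ^ j))) (j≤2^j j))

  search : ∀ k → (∀ j → 2 ^ j ∣ n → j ≤ k) → ∃ (IsValuation₂ n)
  search zero    above = 0 , 1∣ n , above
  search (suc k) above with 2 ^ suc k ∣? n
  ... | yes 2^k∣n = suc k , 2^k∣n , above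
  ... | no  2^k∤n = search k above′
    where
    above′ : ∀ j → 2 ^ j ∣ n → j ≤ k
    above′ j 2^j∣n with m≤n⇒m<n∨m≡n (above j 2^j∣n)
    ... | inj₁ j<1+k = ≤-pred j<1+k
    ... | inj₂ refl  = contradiction 2^j∣n 2^k∤n

v : ∀ n .{{_ : NonZero n}} → ℕ
v n = proj₁ (valuation∃ n)

{-# OPTIONS --safe #-}

-- SG is the only function whose value at each n is the mex of its values on the options of n, so it
-- suffices that 0 ↦ 0, n ↦ v(n) + 1 is such a function. For n > 0, the option 0 has value 0, and
-- n − 2^j has valuation j when j < v(n). No option p = n − d has valuation k = v(n): otherwise 2^k
-- divides d, while 2^(k+1) does not since d ∣ n, so p and d are odd multiples of 2^k and 2^(k+1)
-- divides their sum n.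

module Submission where

open import Defs
open import Data.List.Base using (List; map)
open import Data.List.Membership.Propositional using (_∈_; _∉_)
open import Data.List.Membership.Propositional.Properties using (∈-map⁺; ∈-map⁻)
open import Data.List.Properties using (map-cong-local)
open import Data.List.Relation.Unary.All using (tabulate)
open import Data.Nat.Base using (ℕ; zero; suc; _+_; _*_; _∸_; _^_; _≤_; _<_; _%_; s≤s; z<s; s<s⁻¹; NonZero)
open import Data.Nat.Divisibility using (_∣_; _∤_; divides-refl; ∣-refl; ∣-trans; ∣⇒≤; >⇒∤; _∣0; 1∣_; m∣m*n; *-monoˡ-∣; *-monoʳ-∣; *-cancelʳ-∣; ∣m+n∣m⇒∣n; m%n≡0⇒n∣m)
open import Data.Nat.DivMod using (%-distribˡ-+; m%n<n)
open import Data.Nat.Induction using (<-rec)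
open import Data.Nat.Properties using (<-cmp; ≤-antisym; ≮⇒≥; n≮n; n≤1+n; n<1+n; +-comm; *-comm; *-distribʳ-+; *-identityʳ; m+[n∸m]≡n; m∸n+n≡m; m^n>0; m^n≢0)
open import Data.Product.Base using (∃; _×_; _,_; proj₁; proj₂)
open import Function.Base using (_∘_)
open import Function.Bundles using (module Equivalence)
open import Relation.Binary.Definitions using (tri<; tri≈; tri>)
open import Relation.Binary.PropositionalEquality using (_≡_; _≢_; refl; sym; cong; cong₂; subst; module ≡-Reasoning)
open import Relation.Nullary.Negation.Core using (¬_; contradiction)

IsMex-unique : ∀ {xs m n} → IsMex xs m → IsMex xs n → m ≡ n
IsMex-unique {m = m} {n} (m∉ , below-m) (n∉ , below-n) with <-cmp m n
... | tri< m<n _ _ = contradiction (below-n m m<n) m∉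
... | tri≈ _ m≡n _ = m≡n
... | tri> _ _ n<m = contradiction (below-m n n<m) n∉

IsMex⇒mex≡ : ∀ {xs m} → IsMex xs m → mex xs ≡ m
IsMex⇒mex≡ {xs} = IsMex-unique (proj₂ (mex∃ xs))

IsMex-map⁺ : ∀ {a} {A : Set a} {f : A → ℕ} {xs m} →
             (∀ {x} → x ∈ xs → f x ≢ m) →
             (∀ {j} → j < m → ∃ λ x → x ∈ xs × f x ≡ j) →
             IsMex (map f xs) m
IsMex-map⁺ {f = f} {xs} {m} avoids attains = m∉ , λ j → below
  where
  m∉ : m ∉ map f xs
  m∉ m∈ = let x , x∈ , m≡fx = ∈-map⁻ f m∈ in avoids x∈ (sym m≡fx)

  below : ∀ {j} → j < m → j ∈ map f xs
  below j<m = let x , x∈ , fx≡j = attains j<m in subst (_∈ map f xs) fx≡j (∈-map⁺ f x∈)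

module _ (options : ℕ → List ℕ) (options-< : ∀ {n p} → p ∈ options n → p < n) where

  private module Game = SpragueGrundy options options-<

  SG-unique : ∀ {g : ℕ → ℕ} → (∀ n → IsMex (map g (options n)) (g n)) → ∀ n → Game.SG n ≡ g n
  SG-unique {g} g-isMex = <-rec (λ n → Game.SG n ≡ g n) λ n ih → begin
    Game.SG n                      ≡⟨ Game.SG-mex n ⟩
    mex (map Game.SG (options n))  ≡⟨ cong mex (map-cong-local (tabulate (ih ∘ options-<))) ⟩
    mex (map g (options n))        ≡⟨ IsMex⇒mex≡ (g-isMex n) ⟩
    g n                            ∎
    where open ≡-Reasoning

^-monoʳ-∣ : ∀ m {j k} → j ≤ k → m ^ j ∣ m ^ k
^-monoʳ-∣ m {zero}          _         = 1∣ _
^-monoʳ-∣ m {suc j} {suc k} (s≤s j≤k) = *-monoʳ-∣ m (^-monoʳ-∣ m j≤k)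

2∤n⇒n%2≡1 : ∀ n → 2 ∤ n → n % 2 ≡ 1
2∤n⇒n%2≡1 n 2∤n with n % 2 in n%2≡r | m%n<n n 2
... | 0           | _              = contradiction (m%n≡0⇒n∣m n 2 n%2≡r) 2∤n
... | 1           | _              = refl
... | suc (suc _) | s≤s (s≤s ())

2∤m∧2∤n⇒2∣m+n : ∀ {m n} → 2 ∤ m → 2 ∤ n → 2 ∣ m + n
2∤m∧2∤n⇒2∣m+n {m} {n} 2∤m 2∤n = m%n≡0⇒n∣m (m + n) 2 (begin
  (m + n) % 2          ≡⟨ %-distribˡ-+ m n 2 ⟩
  (m % 2 + n % 2) % 2  ≡⟨ cong₂ (λ r s → (r + s) % 2) (2∤n⇒n%2≡1 m 2∤m) (2∤n⇒n%2≡1 n 2∤n) ⟩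
  0                    ∎)
  where open ≡-Reasoning

IsValuation₂-unique : ∀ {n j k} → IsValuation₂ n j → IsValuation₂ n k → j ≡ k
IsValuation₂-unique (2^j∣n , max-j) (2^k∣n , max-k) = ≤-antisym (max-k _ 2^j∣n) (max-j _ 2^k∣n)

v-isValuation₂ : ∀ n .{{_ : NonZero n}} → IsValuation₂ n (v n)
v-isValuation₂ n = proj₂ (valuation∃ n)

IsValuation₂⇒v≡ : ∀ {n k} .{{_ : NonZero n}} → IsValuation₂ n k → v n ≡ k
IsValuation₂⇒v≡ {n} = IsValuation₂-unique (v-isValuation₂ n)

IsValuation₂⇒2^1+k∤n : ∀ {n k} → IsValuation₂ n k → 2 ^ suc k ∤ n
IsValuation₂⇒2^1+k∤n {k = k} (_ , max-k) 2^1+k∣n = n≮n k (max-k (suc k) 2^1+k∣n)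

IsValuation₂⁺ : ∀ {n k} → 2 ^ k ∣ n → 2 ^ suc k ∤ n → IsValuation₂ n k
IsValuation₂⁺ 2^k∣n 2^1+k∤n =
  2^k∣n , λ j 2^j∣n → ≮⇒≥ λ k<j → 2^1+k∤n (∣-trans (^-monoʳ-∣ 2 k<j) 2^j∣n)

2∤m⇒IsValuation₂[2^k*m] : ∀ k {m} → 2 ∤ m → IsValuation₂ (2 ^ k * m) k
2∤m⇒IsValuation₂[2^k*m] k {m} 2∤m = IsValuation₂⁺ (m∣m*n m) λ 2^1+k∣2^k*m →
  2∤m (*-cancelʳ-∣ (2 ^ k) {{m^n≢0 2 k}} (subst (2 ^ suc k ∣_) (*-comm (2 ^ k) m) 2^1+k∣2^k*m))

IsValuation₂[2^k] : ∀ k → IsValuation₂ (2 ^ k) k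
IsValuation₂[2^k] k =
  subst (λ n → IsValuation₂ n k) (*-identityʳ (2 ^ k)) (2∤m⇒IsValuation₂[2^k*m] k (>⇒∤ (n<1+n 1)))

IsValuation₂⇒2^1+k∣m+n : ∀ {m n k} → IsValuation₂ m k → IsValuation₂ n k → 2 ^ suc k ∣ m + n
IsValuation₂⇒2^1+k∣m+n {k = k} val-m@(divides-refl a , _) val-n@(divides-refl b , _) =
  subst (2 ^ suc k ∣_) (*-distribʳ-+ (2 ^ k) a b)
    (*-monoˡ-∣ (2 ^ k) (2∤m∧2∤n⇒2∣m+n (quotient-odd a val-m) (quotient-odd b val-n)))
  where
  quotient-odd : ∀ q → IsValuation₂ (q * 2 ^ k) k → 2 ∤ q
  quotient-odd _ val 2∣q = IsValuation₂⇒2^1+k∤n val (*-monoˡ-∣ (2 ^ k) 2∣q)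

2^1+k∣m+n⇒IsValuation₂ : ∀ {m n k} → IsValuation₂ m k → 2 ^ suc k ∣ m + n → IsValuation₂ n k
2^1+k∣m+n⇒IsValuation₂ {m} {n} {k} val-m@(2^k∣m , _) 2^1+k∣m+n = IsValuation₂⁺
  (∣m+n∣m⇒∣n (∣-trans (^-monoʳ-∣ 2 (n≤1+n k)) 2^1+k∣m+n) 2^k∣m)
  (IsValuation₂⇒2^1+k∤n val-m ∘ ∣m+n∣m⇒∣n (subst (2 ^ suc k ∣_) (+-comm m n) 2^1+k∣m+n))

option-changes-valuation : ∀ {n p k} → p ∈ opt n → IsValuation₂ n k → ¬ IsValuation₂ p k
option-changes-valuation {n} {p} {k} p∈ val-n val-p with Equivalence.to (∈-opt n p) p∈
... | d , _ , d∣n , refl = IsValuation₂⇒2^1+k∤n val-n (IsValuation₂⇒2^1+k∣m+n val-p val-d)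
  where
  val-d : IsValuation₂ d k
  val-d = IsValuation₂⁺ (∣m+n∣m⇒∣n (proj₁ val-n) (proj₁ val-p))
            λ 2^1+k∣d → IsValuation₂⇒2^1+k∤n val-n (∣-trans 2^1+k∣d d∣n)

option-of-smaller-valuation : ∀ {n j k} .{{_ : NonZero n}} → IsValuation₂ n k → j < k →
                              ∃ λ p → p ∈ opt n × IsValuation₂ p j
option-of-smaller-valuation {n} {j} (2^k∣n , _) j<k =
  n ∸ 2 ^ j ,
  Equivalence.from (∈-opt n (n ∸ 2 ^ j)) (2 ^ j , m^n>0 2 j , 2^j∣n , m∸n+n≡m 2^j≤n) ,
  2^1+k∣m+n⇒IsValuation₂ (IsValuation₂[2^k] j)
    (subst (2 ^ suc j ∣_) (sym (m+[n∸m]≡n 2^j≤n)) 2^1+j∣n)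
  where
  2^1+j∣n : 2 ^ suc j ∣ n
  2^1+j∣n = ∣-trans (^-monoʳ-∣ 2 j<k) 2^k∣n

  2^j∣n : 2 ^ j ∣ n
  2^j∣n = ∣-trans (^-monoʳ-∣ 2 (n≤1+n j)) 2^1+j∣n

  2^j≤n : 2 ^ j ≤ n
  2^j≤n = ∣⇒≤ 2^j∣n

grundy : ℕ → ℕ
grundy zero      = 0
grundy n@(suc _) = suc (v n)

IsValuation₂⇒grundy≡1+k : ∀ {n k} → IsValuation₂ n k → grundy n ≡ suc k
IsValuation₂⇒grundy≡1+k {zero}  val = contradiction (_ ∣0) (IsValuation₂⇒2^1+k∤n val)
IsValuation₂⇒grundy≡1+k {suc _} val = cong suc (IsValuation₂⇒v≡ val)

grundy≡1+k⇒IsValuation₂ : ∀ {n k} → grundy n ≡ suc k → IsValuation₂ n k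
grundy≡1+k⇒IsValuation₂ {suc _} refl = v-isValuation₂ _

option-changes-grundy : ∀ {n p} → p ∈ opt n → grundy p ≢ grundy n
option-changes-grundy {n@(suc _)} p∈ grundy≡ =
  option-changes-valuation p∈ (v-isValuation₂ n) (grundy≡1+k⇒IsValuation₂ grundy≡)

option-of-smaller-grundy : ∀ {n j} → j < grundy n → ∃ λ p → p ∈ opt n × grundy p ≡ j
option-of-smaller-grundy {n@(suc _)} {zero} _ =
  0 , Equivalence.from (∈-opt n 0) (n , z<s , ∣-refl , refl) , refl
option-of-smaller-grundy {n@(suc _)} {suc j} 1+j<1+v =
  let p , p∈ , val-p = option-of-smaller-valuation (v-isValuation₂ n) (s<s⁻¹ 1+j<1+v)
  in  p , p∈ , IsValuation₂⇒grundy≡1+k val-p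

SG≡grundy : ∀ n → SG n ≡ grundy n
SG≡grundy = SG-unique opt opt-< λ n → IsMex-map⁺ option-changes-grundy option-of-smaller-grundy

mainTheorem2 : SG 0 ≡ 0 ×
    (∀ (n : ℕ) .{{_ : NonZero n}} (k m : ℕ) → n ≡ 2 ^ k * m → 2 ∤ m →
    SG n ≡ v n + 1 × v n + 1 ≡ k + 1)
mainTheorem2 = SG≡grundy 0 , λ { n k m refl 2∤m →
  SG≡v+1 n , cong (_+ 1) (IsValuation₂⇒v≡ (2∤m⇒IsValuation₂[2^k*m] k 2∤m)) }
  where
  open ≡-Reasoning

  SG≡v+1 : ∀ n .{{_ : NonZero n}} → SG n ≡ v n + 1
  SG≡v+1 n = begin
    SG n      ≡⟨ SG≡grundy n ⟩
    grundy n  ≡⟨ IsValuation₂⇒grundy≡1+k (v-isValuation₂ n) ⟩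
    1 + v n   ≡⟨ +-comm 1 (v n) ⟩
    v n + 1   ∎
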